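{- Let $n\ge 1$ and let $\mathit{Enc}:\{0,1,\ldots,2^n-1\}\to\{0,1\}^n$ be any space-optimal code, with increment function $\mathit{Inc}$. Then every decision assignment tree that implements $\mathit{Inc}$ reads at least $\frac n2$ bits in the worst case, i.e. has a leaf of depth at least $\frac n2$. In other words, there is no space-optimal code whose increment function can be implemented by a decision assignment tree that never reads more than $\frac n2-1$ bits.
   Context: A space-optimal code is a bijective encoding function $\mathit{Enc}$ from $\{0,1,\ldots,2^n-1\}$ to $\{0,1\}^n$; put $\mathit{Dec}=\mathit{Enc}^{ -1}$. The increment function is the map $\mathit{Inc}:\{0,1\}^n\to\{0,1\}^n$, $\mathit{Inc}(x)=\mathit{Enc}(\mathit{Dec}(x)+1)$, where the addition is modulo $2^n$, so that $\mathit{Inc}(\mathit{Enc}(2^n-1))=\mathit{Enc}(0)$. A decision assignment tree (DAT) on $n$-bit inputs is a binary tree in which each inner node specifies a single position in $\{1,\ldots,n\}$ and has a left and a right child, and each leaf contains a set of assignments, i.e. a set of positions together with a value in $\{0,1\}$ for each of them. Execution on an input $x\in\{0,1\}^n$ starts at the root; at an inner node specifying position $p$ it moves to the left child if $x_p=0$ and to the right child if $x_p=1$. When a leaf is reached, the output is obtained from $x$ by setting the bits at the positions specified by the leaf to the specified values. A DAT implements a function $f:\{0,1\}^n\to\{0,1\}^n$ if its output on every $x$ is $f(x)$. The number of bits read on an input is the depth of the leaf reached (the root has depth $0$). -}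

module Defs where

open import Data.Bool.Base using (Bool; if_then_else_)
open import Data.Fin.Base using (Fin; toℕ)
open import Data.Maybe.Base using (Maybe; fromMaybe)
open import Data.Nat.Base using (ℕ; suc; _^_)
open import Data.Nat.DivMod using (_mod_)
open import Data.Nat.Properties using (m^n≢0)
open import Data.Vec.Base using (Vec; lookup; zipWith)
open import Function.Bundles using (_↔_; module Inverse)
open import Relation.Binary.PropositionalEquality.Core using (_≡_)

Bits : ℕ → Set
Bits n = Vec Bool n

-- `Inverse.to` is Enc and `Inverse.from` is Dec.
SpaceOptimalCode : ℕ → Set
SpaceOptimalCode n = Fin (2 ^ n) ↔ Bits n

Inc : ∀ {n} → SpaceOptimalCode n → Bits n → Bits n
Inc {n} code x = Enc (_mod_ (suc (toℕ (Dec x))) (2 ^ n) {{m^n≢0 2 n}})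
  where open Inverse code renaming (to to Enc; from to Dec)

-- `nothing` at a position means that the position is not assigned, so that
-- each position receives at most one value.
Assignments : ℕ → Set
Assignments n = Vec (Maybe Bool) n

assign : ∀ {n} → Assignments n → Bits n → Bits n
assign = zipWith (λ a b → fromMaybe b a)

data DAT (n : ℕ) : Set where
  leaf : Assignments n → DAT n
  node : (p : Fin n) (l r : DAT n) → DAT n

data Leaf {n : ℕ} : DAT n → Set where
  here  : ∀ {as} → Leaf (leaf as)
  left  : ∀ {p l r} → Leaf l → Leaf (node p l r)
  right : ∀ {p l r} → Leaf r → Leaf (node p l r)

depth : ∀ {n} {t : DAT n} → Leaf t → ℕ
depth here      = 0
depth (left i)  = suc (depth i)
depth (right i) = suc (depth i)

assignmentsAt : ∀ {n} {t : DAT n} → Leaf t → Assignments n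
assignmentsAt {t = leaf as} here = as
assignmentsAt (left i)           = assignmentsAt i
assignmentsAt (right i)          = assignmentsAt i

leafReached : ∀ {n} (t : DAT n) → Bits n → Leaf t
leafReached (leaf as)    x = here
leafReached (node p l r) x =
  if lookup x p then right (leafReached r x) else left (leafReached l x)

output : ∀ {n} → DAT n → Bits n → Bits n
output t x = assign (assignmentsAt (leafReached t x)) x

Implements : ∀ {n} → DAT n → (Bits n → Bits n) → Set
Implements t f = ∀ x → output t x ≡ f x

-- A position queried twice along a path counts twice.
bitsRead : ∀ {n} → DAT n → Bits n → ℕ
bitsRead t x = depth (leafReached t x)

{-# OPTIONS --safe #-}
module Submission where

-- Inc is a cycle of even length 2ⁿ, hence an odd permutation. Suppose every leaf
-- has depth less than n/2. The inputs reaching a leaf form a subcube fixing fewer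
-- than n/2 positions, and since Inc is injective the leaf may only write
-- positions that are fixed there. Count the pairs of strings whose lexicographic
-- order Inc reverses. No pair inside one subcube is reversed. For two different
-- subcubes C and D, the number of x ∈ C and y ∈ D with x before y is even, because
-- C and D are disjoint and fix fewer than n positions together; the same holds
-- for their images, so the number of reversed pairs is even. Hence Inc would be
-- an even permutation.

open import Defs
open import Algebra.Bundles using (CommutativeMonoid)
import Algebra.Properties.CommutativeSemigroup as CommutativeSemigroup
open import Data.Bool.Base using (Bool; true; false; not; _∧_; _xor_; if_then_else_)
open import Data.Bool.Properties
  using (xor-assoc; xor-identityʳ; xor-same; not-involutive; ∧-zeroʳ; ∧-comm)
  renaming (_≟_ to _≟ᵇ_)
open import Data.Bool.Solver using (module xor-∧-Solver)
open import Data.Fin.Base using (Fin; zero; suc; toℕ; fromℕ; inject₁)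
open import Data.Fin.Properties
  using (any?; suc-injective; toℕ-injective; toℕ-fromℕ<; toℕ-fromℕ; toℕ-inject₁; toℕ<n)
open import Data.Fin.Relation.Unary.Top using (view; ‵fromℕ; ‵inject₁)
open import Data.List.Base using (List; []; _∷_; _++_; [_]; map; concatMap; tabulate)
open import Data.List.Membership.Propositional using (_∈_)
open import Data.List.Membership.Propositional.Properties
  using (∈-map⁺; ∈-map⁻; ∈-++⁺ˡ; ∈-++⁺ʳ; ∈-++⁻; ∈-tabulate⁺)
open import Data.List.Membership.Propositional.Properties.WithK using (unique∧set⇒bag)
open import Data.List.Properties
  using (++-identityʳ; map-tabulate; concatMap-++; map-∘; map-++; tabulate-cong)
open import Data.List.Relation.Binary.BagAndSetEquality using (∼bag⇒↭)
open import Data.List.Relation.Binary.Disjoint.Propositional using (Disjoint)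
open import Data.List.Relation.Binary.Permutation.Propositional
  using (_↭_; prep; swap; ↭-refl; ↭-reflexive; ↭-sym; ↭-trans; ↭⇒↭ₛ)
open import Data.List.Relation.Binary.Permutation.Propositional.Properties
  using (∈-resp-↭; ++-commutativeMonoid) renaming (map⁺ to ↭-map⁺; ++⁺ to ↭-++⁺)
import Data.List.Relation.Binary.Permutation.Setoid.Properties as Permutationₛ
open import Data.List.Relation.Unary.All as All using (All; []; _∷_)
open import Data.List.Relation.Unary.All.Properties using (++⁻ʳ; ++⁺)
open import Data.List.Relation.Unary.AllPairs using ([]; _∷_)
open import Data.List.Relation.Unary.Any using (here; there)
open import Data.List.Relation.Unary.Unique.Propositional using (Unique)
import Data.List.Relation.Unary.Unique.Propositional.Properties as Unique
open import Data.Maybe.Base using (just; nothing; fromMaybe; _<∣>_)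
open import Data.Nat.Base using (ℕ; zero; suc; _+_; _*_; _^_; _≤_; _<_; s≤s; s<s⁻¹; NonZero)
open import Data.Nat.DivMod using (_mod_; _%_; m<n⇒m%n≡m; n%n≡0)
open import Data.Nat.Properties
  using (_<?_; _≤?_; ≤-trans; ≤-reflexive; ≤-total; ≤-<-trans; <⇒≤; ≮⇒≥; ≰⇒>; +-suc;
         +-mono-≤; +-monoˡ-≤; +-monoʳ-≤; m≤m+n; m+1+n≰m; n≤1+n; m^n≢0)
open import Data.Product.Base using (∃-syntax; ∃₂; _×_; _,_; proj₁; proj₂)
open import Data.Sum.Base using (inj₁; inj₂)
open import Data.Vec.Base using ([]; _∷_; lookup; zipWith; replicate; _[_]≔_)
open import Data.Vec.Properties using (≡-dec; ∷-injectiveʳ; lookup∘updateAt)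
open import Function.Base using (_∘_)
open import Function.Bundles using (module Inverse; mk⇔)
open import Relation.Binary.PropositionalEquality hiding ([_])
open import Relation.Nullary using (yes; no; contradiction)

private
  variable
    A B : Set
    n : ℕ

open ≡-Reasoning

-- Sums modulo 2

-- With the constant summand `true` this is the parity of the length; points are counted in this
-- form below.
⨁ : (A → Bool) → List A → Bool
⨁ f []       = false
⨁ f (x ∷ xs) = f x xor ⨁ f xs

⨁² : (A → B → Bool) → List A → List B → Bool
⨁² f xs ys = ⨁ (λ x → ⨁ (f x) ys) xs

-- Each pair of positions counts once, with the earlier entry as first argument. For an `f` that is
-- not symmetric the value depends on how the list is arranged.
⨁-pairs : (A → A → Bool) → List A → Bool
⨁-pairs f []       = false
⨁-pairs f (x ∷ xs) = ⨁ (f x) xs xor ⨁-pairs f xs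

xor-interchange : ∀ a b c d → (a xor b) xor (c xor d) ≡ (a xor c) xor (b xor d)
xor-interchange = solve 4 (λ a b c d → (a :+ b) :+ (c :+ d) := (a :+ c) :+ (b :+ d)) refl
  where open xor-∧-Solver

⨁-cong : ∀ {f g : A → Bool} xs → (∀ {x} → x ∈ xs → f x ≡ g x) → ⨁ f xs ≡ ⨁ g xs
⨁-cong []       f≗g = refl
⨁-cong (x ∷ xs) f≗g = cong₂ _xor_ (f≗g (here refl)) (⨁-cong xs (f≗g ∘ there))

⨁-false : (xs : List A) → ⨁ (λ _ → false) xs ≡ false
⨁-false []       = refl
⨁-false (x ∷ xs) = ⨁-false xs

⨁-const : ∀ c (xs : List A) → ⨁ (λ _ → c) xs ≡ c ∧ ⨁ (λ _ → true) xs
⨁-const false xs = ⨁-false xs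
⨁-const true  xs = refl

⨁-map : ∀ f (h : A → B) xs → ⨁ f (map h xs) ≡ ⨁ (f ∘ h) xs
⨁-map f h []       = refl
⨁-map f h (x ∷ xs) = cong (f (h x) xor_) (⨁-map f h xs)

⨁-++ : ∀ (f : A → Bool) xs ys → ⨁ f (xs ++ ys) ≡ ⨁ f xs xor ⨁ f ys
⨁-++ f []       ys = refl
⨁-++ f (x ∷ xs) ys = trans (cong (f x xor_) (⨁-++ f xs ys)) (sym (xor-assoc (f x) _ _))

⨁-xor : ∀ (f g : A → Bool) xs → ⨁ (λ x → f x xor g x) xs ≡ ⨁ f xs xor ⨁ g xs
⨁-xor f g []       = refl
⨁-xor f g (x ∷ xs) =
  trans (cong ((f x xor g x) xor_) (⨁-xor f g xs)) (xor-interchange (f x) (g x) _ _)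

xor-swap : ∀ a b c → a xor (b xor c) ≡ b xor (a xor c)
xor-swap = solve 3 (λ a b c → a :+ (b :+ c) := b :+ (a :+ c)) refl
  where open xor-∧-Solver

⨁-↭ : ∀ (f : A → Bool) {xs ys} → xs ↭ ys → ⨁ f xs ≡ ⨁ f ys
⨁-↭ f _↭_.refl        = refl
⨁-↭ f (prep x p)      = cong (f x xor_) (⨁-↭ f p)
⨁-↭ f (swap x y p)    =
  trans (xor-swap (f x) (f y) _) (cong (λ s → f y xor (f x xor s)) (⨁-↭ f p))
⨁-↭ f (_↭_.trans p q) = trans (⨁-↭ f p) (⨁-↭ f q)

⨁²-cong : ∀ {f g : A → B → Bool} xs ys →
          (∀ {x y} → x ∈ xs → y ∈ ys → f x y ≡ g x y) → ⨁² f xs ys ≡ ⨁² g xs ys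
⨁²-cong xs ys f≗g = ⨁-cong xs λ x∈ → ⨁-cong ys (f≗g x∈)

⨁²-const : ∀ c (xs : List A) (ys : List B) →
           ⨁² (λ _ _ → c) xs ys ≡ c ∧ (⨁ (λ _ → true) xs ∧ ⨁ (λ _ → true) ys)
⨁²-const false xs ys = trans (⨁-cong xs (λ _ → ⨁-false ys)) (⨁-false xs)
⨁²-const true  xs ys = trans (⨁-const _ xs) (∧-comm (⨁ (λ _ → true) ys) _)

⨁²-map : ∀ (f : B → B → Bool) (h k : A → B) xs ys →
         ⨁² f (map h xs) (map k ys) ≡ ⨁² (λ x y → f (h x) (k y)) xs ys
⨁²-map f h k xs ys = trans (⨁-map _ h xs) (⨁-cong xs λ {x} _ → ⨁-map (f (h x)) k ys)

⨁²-++ˡ : ∀ (f : A → B → Bool) xs xs′ ys →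
         ⨁² f (xs ++ xs′) ys ≡ ⨁² f xs ys xor ⨁² f xs′ ys
⨁²-++ˡ f xs xs′ ys = ⨁-++ _ xs xs′

⨁²-xor : ∀ (f g : A → B → Bool) xs ys →
         ⨁² (λ x y → f x y xor g x y) xs ys ≡ ⨁² f xs ys xor ⨁² g xs ys
⨁²-xor f g xs ys =
  trans (⨁-cong xs λ {x} _ → ⨁-xor (f x) (g x) ys) (⨁-xor (λ x → ⨁ (f x) ys) _ xs)

⨁²-++ʳ : ∀ (f : A → B → Bool) xs ys ys′ →
         ⨁² f xs (ys ++ ys′) ≡ ⨁² f xs ys xor ⨁² f xs ys′
⨁²-++ʳ f xs ys ys′ =
  trans (⨁-cong xs λ {x} _ → ⨁-++ (f x) ys ys′) (⨁-xor (λ x → ⨁ (f x) ys) _ xs)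

⨁-pairs-false : ∀ {f : A → A → Bool} xs →
                (∀ {x y} → x ∈ xs → y ∈ xs → f x y ≡ false) → ⨁-pairs f xs ≡ false
⨁-pairs-false []       f≗false = refl
⨁-pairs-false (x ∷ xs) f≗false = cong₂ _xor_
  (trans (⨁-cong xs (f≗false (here refl) ∘ there)) (⨁-false xs))
  (⨁-pairs-false xs λ x∈ y∈ → f≗false (there x∈) (there y∈))

⨁-pairs-map : ∀ (f : B → B → Bool) (h : A → B) xs →
              ⨁-pairs f (map h xs) ≡ ⨁-pairs (λ x y → f (h x) (h y)) xs
⨁-pairs-map f h []       = refl
⨁-pairs-map f h (x ∷ xs) = cong₂ _xor_ (⨁-map (f (h x)) h xs) (⨁-pairs-map f h xs)

⨁-pairs-xor : ∀ (f g : A → A → Bool) xs →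
              ⨁-pairs (λ x y → f x y xor g x y) xs ≡ ⨁-pairs f xs xor ⨁-pairs g xs
⨁-pairs-xor f g []       = refl
⨁-pairs-xor f g (x ∷ xs) =
  trans (cong₂ _xor_ (⨁-xor (f x) (g x) xs) (⨁-pairs-xor f g xs))
        (xor-interchange (⨁ (f x) xs) _ _ _)

⨁-pairs-++ : ∀ (f : A → A → Bool) xs ys →
             ⨁-pairs f (xs ++ ys) ≡ ⨁² f xs ys xor (⨁-pairs f xs xor ⨁-pairs f ys)
⨁-pairs-++ f []       ys = refl
⨁-pairs-++ f (x ∷ xs) ys =
  trans (cong₂ _xor_ (⨁-++ (f x) xs ys) (⨁-pairs-++ f xs ys))
        (rearrange (⨁ (f x) xs) (⨁ (f x) ys) _ _ _)
  where
  open xor-∧-Solver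
  rearrange : ∀ a b c d e → (a xor b) xor (c xor (d xor e)) ≡ (b xor c) xor ((a xor d) xor e)
  rearrange = solve 5 (λ a b c d e →
    (a :+ b) :+ (c :+ (d :+ e)) := (b :+ c) :+ ((a :+ d) :+ e)) refl

-- By symmetry it does not matter which member of a pair comes first. One sum can thus be evaluated
-- along two enumerations of the strings.
⨁-pairs-↭ : ∀ (f : A → A → Bool) → (∀ x y → f x y ≡ f y x) →
            ∀ {xs ys} → xs ↭ ys → ⨁-pairs f xs ≡ ⨁-pairs f ys
⨁-pairs-↭ f f-sym _↭_.refl        = refl
⨁-pairs-↭ f f-sym (prep x p)      = cong₂ _xor_ (⨁-↭ (f x) p) (⨁-pairs-↭ f f-sym p)
⨁-pairs-↭ f f-sym (swap {xs} {ys} x y p) = begin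
  (f x y xor ⨁ (f x) xs) xor (⨁ (f y) xs xor ⨁-pairs f xs)
    ≡⟨ xor-interchange (f x y) _ _ _ ⟩
  (f x y xor ⨁ (f y) xs) xor (⨁ (f x) xs xor ⨁-pairs f xs)
    ≡⟨ cong₂ _xor_ (cong₂ _xor_ (f-sym x y) (⨁-↭ (f y) p))
                   (cong₂ _xor_ (⨁-↭ (f x) p) (⨁-pairs-↭ f f-sym p)) ⟩
  (f y x xor ⨁ (f y) ys) xor (⨁ (f x) ys xor ⨁-pairs f ys) ∎
⨁-pairs-↭ f f-sym (_↭_.trans p q) = trans (⨁-pairs-↭ f f-sym p) (⨁-pairs-↭ f f-sym q)

Unique-++⁻ : ∀ (xs : List A) {ys} → Unique (xs ++ ys) → Unique ys × Disjoint xs ys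
Unique-++⁻ []       ys!         = ys! , λ ()
Unique-++⁻ (x ∷ xs) (x∉ ∷ xys!) with ys! , xs#ys ← Unique-++⁻ xs xys! = ys! , λ where
  (here refl , v∈ys) → All.lookup (++⁻ʳ xs x∉) v∈ys refl
  (there v∈xs , v∈ys) → xs#ys (v∈xs , v∈ys)

-- The lexicographic order and the pairs that a map reverses

-- The strict lexicographic order with `false` below `true`: where the heads differ, `c` being
-- `true` forces `b` to be `false`.
precedes : Bits n → Bits n → Bool
precedes []      []      = false
precedes (b ∷ x) (c ∷ y) = if b xor c then c else precedes x y

precedes-antisym : (x y : Bits n) → x ≢ y → precedes x y xor precedes y x ≡ true
precedes-antisym []          []          x≢y = contradiction refl x≢y
precedes-antisym (false ∷ x) (false ∷ y) x≢y = precedes-antisym x y (x≢y ∘ cong (false ∷_))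
precedes-antisym (false ∷ x) (true ∷ y)  x≢y = refl
precedes-antisym (true ∷ x)  (false ∷ y) x≢y = refl
precedes-antisym (true ∷ x)  (true ∷ y)  x≢y = precedes-antisym x y (x≢y ∘ cong (true ∷_))

-- For injective `f` and distinct `x` and `y`, this tells whether `f` reverses their order. Summed
-- over all pairs of strings, it gives the sign of the permutation `f`.
inverts : (Bits n → Bits n) → Bits n → Bits n → Bool
inverts f x y = precedes x y xor precedes (f x) (f y)

-- For distinct strings, exchanging `x` and `y` flips both comparisons, which leaves their sum
-- unchanged. Injectivity keeps the images distinct.
inverts-sym : (f : Bits n → Bits n) → (∀ {x y} → f x ≡ f y → x ≡ y) →
              ∀ x y → inverts f x y ≡ inverts f y x
inverts-sym f f-inj x y with ≡-dec _≟ᵇ_ x y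
... | yes refl = refl
... | no x≢y = xor-cancel (precedes x y) _ _ _
  (trans (precedes-antisym x y x≢y) (sym (precedes-antisym (f x) (f y) (x≢y ∘ f-inj))))
  where
  open xor-∧-Solver
  xor-cancel : ∀ a b c d → a xor b ≡ c xor d → a xor c ≡ b xor d
  xor-cancel a b c d ab≡cd = begin
    a xor c                     ≡⟨ solve 3 (λ a b c → a :+ c := (a :+ b) :+ (b :+ c)) refl a b c ⟩
    (a xor b) xor (b xor c)     ≡⟨ cong (_xor (b xor c)) ab≡cd ⟩
    (c xor d) xor (b xor c)     ≡⟨ solve 3 (λ b c d → (c :+ d) :+ (b :+ c) := b :+ d) refl b c d ⟩
    b xor d                     ∎

-- Rotations

-- Only the pairs containing the rotated string x change their relative order.
rotation-odd : ∀ (x : Bits n) xs → Unique (x ∷ xs) →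
               ⨁-pairs precedes (x ∷ xs) xor ⨁-pairs precedes (xs ++ [ x ]) ≡ ⨁ (λ _ → true) xs
rotation-odd x xs (x∉xs ∷ _) = begin
  (⨁ (precedes x) xs xor P) xor ⨁-pairs precedes (xs ++ [ x ])
    ≡⟨ cong ((⨁ (precedes x) xs xor P) xor_) (⨁-pairs-++ precedes xs [ x ]) ⟩
  (⨁ (precedes x) xs xor P) xor (⨁² precedes xs [ x ] xor (P xor false))
    ≡⟨ solve 3 (λ a p b → (a :+ p) :+ (b :+ (p :+ con false)) := a :+ b) refl
         (⨁ (precedes x) xs) P (⨁² precedes xs [ x ]) ⟩
  ⨁ (precedes x) xs xor ⨁² precedes xs [ x ]
    ≡⟨ ⨁-xor (precedes x) _ xs ⟨
  ⨁ (λ y → precedes x y xor (precedes y x xor false)) xs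
    ≡⟨ ⨁-cong xs (λ {y} y∈xs → trans (cong (precedes x y xor_) (xor-identityʳ _))
         (precedes-antisym x y (All.lookup x∉xs y∈xs))) ⟩
  ⨁ (λ _ → true) xs ∎
  where
  open xor-∧-Solver
  P = ⨁-pairs precedes xs

tabulate-∷ʳ : ∀ {m} (f : Fin (suc m) → A) → tabulate f ≡ tabulate (f ∘ inject₁) ++ [ f (fromℕ m) ]
tabulate-∷ʳ {m = zero}  f = refl
tabulate-∷ʳ {m = suc m} f = cong (f zero ∷_) (tabulate-∷ʳ (f ∘ suc))

suc-mod-inject₁ : ∀ {m} (i : Fin m) → suc (toℕ (inject₁ i)) mod suc m ≡ suc i
suc-mod-inject₁ {m} i = toℕ-injective (trans (toℕ-fromℕ< _)
  (trans (cong (λ k → suc k % suc m) (toℕ-inject₁ i)) (m<n⇒m%n≡m (s≤s (toℕ<n i)))))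

suc-mod-fromℕ : ∀ m → suc (toℕ (fromℕ m)) mod suc m ≡ zero
suc-mod-fromℕ m = toℕ-injective (trans (toℕ-fromℕ< _)
  (trans (cong (λ k → suc k % suc m) (toℕ-fromℕ m)) (n%n≡0 (suc m))))

suc-mod-injective : ∀ {m} .{{_ : NonZero m}} {i j : Fin m} →
                    suc (toℕ i) mod m ≡ suc (toℕ j) mod m → i ≡ j
suc-mod-injective {suc m} {i = i} {j} eq with view i | view j
... | ‵fromℕ     | ‵fromℕ     = refl
... | ‵fromℕ     | ‵inject₁ j =
  contradiction (trans (sym (suc-mod-fromℕ m)) (trans eq (suc-mod-inject₁ j))) λ ()
... | ‵inject₁ i | ‵fromℕ     =
  contradiction (trans (sym (suc-mod-inject₁ i)) (trans eq (suc-mod-fromℕ m))) λ ()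
... | ‵inject₁ i | ‵inject₁ j = cong inject₁
  (suc-injective (trans (sym (suc-mod-inject₁ i)) (trans eq (suc-mod-inject₁ j))))

-- Applied to `Enc`, this presents the codewords and their images under `Inc` as the two lists
-- compared in `rotation-odd`.
tabulate-rotate : ∀ {m} .{{_ : NonZero m}} (f : Fin m → A) →
  ∃₂ λ x xs → tabulate f ≡ x ∷ xs × tabulate (λ (i : Fin m) → f (suc (toℕ i) mod m)) ≡ xs ++ [ x ]
tabulate-rotate {m = suc m} f = f zero , tabulate (f ∘ suc) , refl ,
  trans (tabulate-∷ʳ (λ i → f (suc (toℕ i) mod suc m))) (cong₂ (λ xs x → xs ++ [ x ])
    (tabulate-cong {f = λ i → f (suc (toℕ (inject₁ i)) mod suc m)} (cong f ∘ suc-mod-inject₁))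
    (cong f (suc-mod-fromℕ m)))

-- Subcubes

-- `just b` fixes a position to `b` and `nothing` leaves it free. Sharing the type with the writes
-- of a leaf lets `image` combine the two position by position.
Cube : ℕ → Set
Cube = Assignments

points : Cube n → List (Bits n)
points []            = [ [] ]
points (nothing ∷ C) = map (false ∷_) (points C) ++ map (true ∷_) (points C)
points (just b ∷ C)  = map (b ∷_) (points C)

fixed : Cube n → ℕ
fixed []            = 0
fixed (nothing ∷ C) = fixed C
fixed (just _ ∷ C)  = suc (fixed C)

∈-nothing : ∀ b (C : Cube n) {x} → x ∈ points C → b ∷ x ∈ points (nothing ∷ C)
∈-nothing false C x∈C = ∈-++⁺ˡ (∈-map⁺ _ x∈C)
∈-nothing true  C x∈C = ∈-++⁺ʳ _ (∈-map⁺ _ x∈C)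

free : ∀ n → Cube n
free n = replicate n nothing

fixed-free : ∀ n → fixed (free n) ≡ 0
fixed-free zero    = refl
fixed-free (suc n) = fixed-free n

∈-free : (x : Bits n) → x ∈ points (free n)
∈-free []      = here refl
∈-free (b ∷ x) = ∈-nothing b (free _) (∈-free x)

points-nonempty : (C : Cube n) → ∃[ x ] x ∈ points C
points-nonempty []            = [] , here refl
points-nonempty (nothing ∷ C) = let x , x∈C = points-nonempty C in
  false ∷ x , ∈-nothing false C x∈C
points-nonempty (just b ∷ C)  = let x , x∈C = points-nonempty C in
  b ∷ x , ∈-map⁺ _ x∈C

points-unique : (C : Cube n) → Unique (points C)
points-unique []            = [] ∷ []
points-unique (just b ∷ C)  = Unique.map⁺ ∷-injectiveʳ (points-unique C)
points-unique (nothing ∷ C) =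
  Unique.++⁺ (Unique.map⁺ ∷-injectiveʳ (points-unique C))
             (Unique.map⁺ ∷-injectiveʳ (points-unique C)) apart
  where
  apart : Disjoint (map (false ∷_) (points C)) (map (true ∷_) (points C))
  apart (v∈₀ , v∈₁) with ∈-map⁻ _ v∈₀ | ∈-map⁻ _ v∈₁
  ... | _ , _ , refl | _ , _ , ()

lookup-points : ∀ (C : Cube n) p {b x} → lookup C p ≡ just b → x ∈ points C → lookup x p ≡ b
lookup-points (just c ∷ C) zero refl x∈ with ∈-map⁻ _ x∈
... | _ , _ , refl = refl
lookup-points (just c ∷ C) (suc p) eq x∈ with ∈-map⁻ _ x∈
... | _ , y∈ , refl = lookup-points C p eq y∈
lookup-points (nothing ∷ C) (suc p) eq x∈ with ∈-++⁻ (map (false ∷_) (points C)) x∈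
... | inj₁ x∈₀ with ∈-map⁻ _ x∈₀
...   | _ , y∈ , refl = lookup-points C p eq y∈
lookup-points (nothing ∷ C) (suc p) eq x∈ | inj₂ x∈₁ with ∈-map⁻ _ x∈₁
...   | _ , y∈ , refl = lookup-points C p eq y∈

-- In general only a permutation: a free position before `p` makes the two halves interleave in the
-- enumeration of `C`.
points-split : ∀ (C : Cube n) p → lookup C p ≡ nothing →
  points (C [ p ]≔ just false) ++ points (C [ p ]≔ just true) ↭ points C
points-split (nothing ∷ C) zero    eq = ↭-refl
points-split (just b ∷ C)  (suc p) eq =
  ↭-trans (↭-reflexive (sym (map-++ (b ∷_) (points (C [ p ]≔ just false)) _)))
          (↭-map⁺ (b ∷_) (points-split C p eq))
points-split (nothing ∷ C) (suc p) eq =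
  ↭-trans (interchange (map (false ∷_) P₀) (map (true ∷_) P₀) _ _)
  (↭-trans (↭-reflexive (sym (cong₂ _++_ (map-++ (false ∷_) P₀ P₁) (map-++ (true ∷_) P₀ P₁))))
  (↭-++⁺ (↭-map⁺ _ (points-split C p eq)) (↭-map⁺ _ (points-split C p eq))))
  where
  open CommutativeSemigroup
    (CommutativeMonoid.commutativeSemigroup (++-commutativeMonoid {A = Bits _}))
    using (interchange)
  P₀ = points (C [ p ]≔ just false)
  P₁ = points (C [ p ]≔ just true)

fixed-update : ∀ (C : Cube n) p b → lookup C p ≡ nothing → fixed (C [ p ]≔ just b) ≡ suc (fixed C)
fixed-update (nothing ∷ C) zero    b eq = refl
fixed-update (nothing ∷ C) (suc p) b eq = fixed-update C p b eq
fixed-update (just _ ∷ C)  (suc p) b eq = cong suc (fixed-update C p b eq)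

-- Some position is free, and its two values split the points into halves of equal size.
∣points∣-even : ∀ (C : Cube n) → fixed C < n → ⨁ (λ _ → true) (points C) ≡ false
∣points∣-even (nothing ∷ C) _ = begin
  ⨁ (λ _ → true) (map (false ∷_) (points C) ++ map (true ∷_) (points C))
    ≡⟨ ⨁-++ _ (map (false ∷_) (points C)) _ ⟩
  ⨁ (λ _ → true) (map (false ∷_) (points C)) xor ⨁ (λ _ → true) (map (true ∷_) (points C))
    ≡⟨ cong₂ _xor_ (⨁-map _ _ (points C)) (⨁-map _ _ (points C)) ⟩
  ⨁ (λ _ → true) (points C) xor ⨁ (λ _ → true) (points C)
    ≡⟨ xor-same (⨁ (λ _ → true) (points C)) ⟩
  false ∎
∣points∣-even (just b ∷ C) (s≤s lt) = trans (⨁-map _ _ (points C)) (∣points∣-even C lt)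

-- The sum of precedes over a product of two subcubes

cross : Cube n → Cube n → Bool
cross C D = ⨁² precedes (points C) (points D)

∣points∣² : Cube n → Cube n → Bool
∣points∣² C D = ⨁ (λ _ → true) (points C) ∧ ⨁ (λ _ → true) (points D)

-- If both subcubes were single points, then `n + n ≤ n`, so both would consist of the empty string.
-- The bound is not strict because `cross-even` calls this after removing a position free in both
-- subcubes.
∣points∣²-even : ∀ (C D : Cube n) → Disjoint (points C) (points D) → fixed C + fixed D ≤ n →
                 ∣points∣² C D ≡ false
∣points∣²-even [] [] C#D _ = contradiction (here refl , here refl) C#D
∣points∣²-even {n = n@(suc _)} C D C#D C+D≤n with fixed C <? n | fixed D <? n
... | yes C<n | _       = cong (_∧ _) (∣points∣-even C C<n)
... | no _    | yes D<n = trans (cong (_ ∧_) (∣points∣-even D D<n)) (∧-zeroʳ _)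
... | no C≮n  | no D≮n  = contradiction
  (≤-trans (+-mono-≤ (≮⇒≥ C≮n) (≮⇒≥ D≮n)) C+D≤n) (m+1+n≰m n)

cross-∷ : ∀ b c (xs ys : List (Bits n)) →
  ⨁² precedes (map (b ∷_) xs) (map (c ∷_) ys) ≡
  (if b xor c then c ∧ (⨁ (λ _ → true) xs ∧ ⨁ (λ _ → true) ys) else ⨁² precedes xs ys)
cross-∷ b c xs ys = trans (⨁²-map precedes (b ∷_) (c ∷_) xs ys) (lemma b c)
  where
  lemma : ∀ b c → ⨁² (λ x y → precedes (b ∷ x) (c ∷ y)) xs ys ≡
          (if b xor c then c ∧ (⨁ (λ _ → true) xs ∧ ⨁ (λ _ → true) ys) else ⨁² precedes xs ys)
  lemma false false = refl
  lemma false true  = ⨁²-const true xs ys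
  lemma true  false = ⨁²-const false xs ys
  lemma true  true  = refl

-- Evenness of `cross C D` is asked for equal heads only: under different heads, the tails of
-- disjoint subcubes may overlap.
cross-∷-even : ∀ b c (C D : Cube n) → ∣points∣² C D ≡ false → (b ≡ c → cross C D ≡ false) →
  ⨁² precedes (map (b ∷_) (points C)) (map (c ∷_) (points D)) ≡ false
cross-∷-even b c C D even₂ even = trans (cross-∷ b c (points C) (points D)) (lemma b c even)
  where
  lemma : ∀ b c → (b ≡ c → cross C D ≡ false) →
          (if b xor c then c ∧ ∣points∣² C D else cross C D) ≡ false
  lemma false false even = even refl
  lemma false true  _    = even₂
  lemma true  false _    = refl
  lemma true  true  even = even refl

-- Disjoint subcubes have a position fixed in both, hence at least two positions
-- free in both. The first of these reduces the sum to the number of pairs of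
-- points of the remaining subcubes, and the second one makes that number even.
cross-even : ∀ (C D : Cube n) → Disjoint (points C) (points D) → fixed C + fixed D < n →
             cross C D ≡ false
cross-even (nothing ∷ C) (nothing ∷ D) C#D (s≤s lt) = begin
  ⨁² precedes (C₀ ++ C₁) (D₀ ++ D₁)
    ≡⟨ ⨁²-++ˡ precedes C₀ C₁ (D₀ ++ D₁) ⟩
  ⨁² precedes C₀ (D₀ ++ D₁) xor ⨁² precedes C₁ (D₀ ++ D₁)
    ≡⟨ cong₂ _xor_ (⨁²-++ʳ precedes C₀ D₀ D₁) (⨁²-++ʳ precedes C₁ D₀ D₁) ⟩
  (⨁² precedes C₀ D₀ xor ⨁² precedes C₀ D₁) xor (⨁² precedes C₁ D₀ xor ⨁² precedes C₁ D₁)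
    ≡⟨ cong₂ _xor_ (cong₂ _xor_ (cross-∷ false false (points C) (points D))
                                (cross-∷ false true (points C) (points D)))
                   (cong₂ _xor_ (cross-∷ true false (points C) (points D))
                                (cross-∷ true true (points C) (points D))) ⟩
  -- The two combinations with equal heads give `cross C D` each and will cancel. Head `false`
  -- against `true` counts every pair, and `true` against `false` counts none.
  (cross C D xor ∣points∣² C D) xor cross C D
    ≡⟨ cong (λ s → (cross C D xor s) xor cross C D) (∣points∣²-even C D tails lt) ⟩
  (cross C D xor false) xor cross C D
    ≡⟨ cong (_xor cross C D) (xor-identityʳ (cross C D)) ⟩
  cross C D xor cross C D
    ≡⟨ xor-same (cross C D) ⟩
  false ∎
  where
  C₀ = map (false ∷_) (points C)
  C₁ = map (true ∷_) (points C)
  D₀ = map (false ∷_) (points D)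
  D₁ = map (true ∷_) (points D)
  tails : Disjoint (points C) (points D)
  tails (v∈C , v∈D) = C#D (∈-nothing false C v∈C , ∈-nothing false D v∈D)
cross-even {n = suc n} (nothing ∷ C) (just c ∷ D) C#D lt = begin
  ⨁² precedes (map (false ∷_) (points C) ++ map (true ∷_) (points C)) (map (c ∷_) (points D))
    ≡⟨ ⨁²-++ˡ precedes (map (false ∷_) (points C)) _ (map (c ∷_) (points D)) ⟩
  ⨁² precedes (map (false ∷_) (points C)) (map (c ∷_) (points D)) xor
  ⨁² precedes (map (true ∷_) (points C)) (map (c ∷_) (points D))
    ≡⟨ cong₂ _xor_ (half false) (half true) ⟩
  false ∎
  where
  lt′ : fixed C + fixed D < n
  lt′ = s<s⁻¹ (subst (_< suc n) (+-suc (fixed C) (fixed D)) lt)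
  tails : Disjoint (points C) (points D)
  tails (v∈C , v∈D) = C#D (∈-nothing c C v∈C , ∈-map⁺ _ v∈D)
  half : ∀ b → ⨁² precedes (map (b ∷_) (points C)) (map (c ∷_) (points D)) ≡ false
  half b = cross-∷-even b c C D (∣points∣²-even C D tails (<⇒≤ lt′)) λ _ → cross-even C D tails lt′
cross-even (just b ∷ C) (nothing ∷ D) C#D (s≤s lt) = begin
  ⨁² precedes (map (b ∷_) (points C)) (map (false ∷_) (points D) ++ map (true ∷_) (points D))
    ≡⟨ ⨁²-++ʳ precedes (map (b ∷_) (points C)) (map (false ∷_) (points D)) _ ⟩
  ⨁² precedes (map (b ∷_) (points C)) (map (false ∷_) (points D)) xor
  ⨁² precedes (map (b ∷_) (points C)) (map (true ∷_) (points D))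
    ≡⟨ cong₂ _xor_ (half false) (half true) ⟩
  false ∎
  where
  tails : Disjoint (points C) (points D)
  tails (v∈C , v∈D) = C#D (∈-map⁺ _ v∈C , ∈-nothing b D v∈D)
  half : ∀ c → ⨁² precedes (map (b ∷_) (points C)) (map (c ∷_) (points D)) ≡ false
  half c = cross-∷-even b c C D (∣points∣²-even C D tails (<⇒≤ lt)) λ _ → cross-even C D tails lt
cross-even {n = suc n} (just b ∷ C) (just c ∷ D) C#D (s≤s lt) =
  cross-∷-even b c C D even₂ λ where
    refl → cross-even C D (λ (v∈C , v∈D) → C#D (∈-map⁺ _ v∈C , ∈-map⁺ _ v∈D)) lt′
  where
  lt′ : fixed C + fixed D < n
  lt′ = ≤-<-trans (+-monoʳ-≤ (fixed C) (n≤1+n _)) lt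
  even₂ : ∣points∣² C D ≡ false
  even₂ = cong (_∧ _) (∣points∣-even C (≤-<-trans (m≤m+n _ _) lt′))

-- Leaves of an injective decision assignment tree

-- In `set` the written `b` may differ from the fixed `c`: such an assignment carries the subcube to
-- a parallel one.
data _within_ : Assignments n → Cube n → Set where
  []   : [] within []
  keep : ∀ {as : Assignments n} {C m} → as within C → (nothing ∷ as) within (m ∷ C)
  set  : ∀ {as : Assignments n} {C b c} → as within C → (just b ∷ as) within (just c ∷ C)

-- Writing a free position would identify two points that differ only there.
injective⇒within : ∀ (as : Assignments n) C →
  (∀ {x y} → x ∈ points C → y ∈ points C → assign as x ≡ assign as y → x ≡ y) → as within C
injective⇒within []             []            inj = []
injective⇒within (nothing ∷ as) (nothing ∷ C) inj =
  keep (injective⇒within as C λ x∈ y∈ eq →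
    ∷-injectiveʳ (inj (∈-nothing false C x∈) (∈-nothing false C y∈) (cong (false ∷_) eq)))
injective⇒within (nothing ∷ as) (just b ∷ C)  inj =
  keep (injective⇒within as C λ x∈ y∈ eq →
    ∷-injectiveʳ (inj (∈-map⁺ _ x∈) (∈-map⁺ _ y∈) (cong (b ∷_) eq)))
injective⇒within (just a ∷ as)  (just b ∷ C)  inj =
  set (injective⇒within as C λ x∈ y∈ eq →
    ∷-injectiveʳ (inj (∈-map⁺ _ x∈) (∈-map⁺ _ y∈) (cong (a ∷_) eq)))
injective⇒within (just a ∷ as)  (nothing ∷ C) inj
  with _ , x∈ ← points-nonempty C
  with () ← inj (∈-nothing false C x∈) (∈-nothing true C x∈) refl

-- Two points of `C` agree on the fixed positions both before and after the assignment, and the free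
-- positions are untouched; so a first difference stays as it was.
precedes-assign : ∀ {as : Assignments n} {C x y} → as within C → x ∈ points C → y ∈ points C →
                  precedes (assign as x) (assign as y) ≡ precedes x y
precedes-assign {x = []} {[]} [] _ _ = refl
precedes-assign {C = just c ∷ C} (keep w) x∈ y∈ with ∈-map⁻ _ x∈ | ∈-map⁻ _ y∈
... | _ , x′∈ , refl | _ , y′∈ , refl = cong (if c xor c then c else_) (precedes-assign w x′∈ y′∈)
precedes-assign {C = just c ∷ C} (set {b = b} w) x∈ y∈ with ∈-map⁻ _ x∈ | ∈-map⁻ _ y∈
... | _ , x′∈ , refl | _ , y′∈ , refl rewrite xor-same b | xor-same c = precedes-assign w x′∈ y′∈
precedes-assign {C = nothing ∷ C} {x = b ∷ _} {c ∷ _} (keep w) x∈ y∈ =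
  cong (if b xor c then c else_) (precedes-assign w (∈-tail x∈) (∈-tail y∈))
  where
  ∈-tail : ∀ {b x} → b ∷ x ∈ points (nothing ∷ C) → x ∈ points C
  ∈-tail x∈ with ∈-++⁻ (map (false ∷_) (points C)) x∈
  ... | inj₁ x∈₀ with _ , y∈ , refl ← ∈-map⁻ _ x∈₀ = y∈
  ... | inj₂ x∈₁ with _ , y∈ , refl ← ∈-map⁻ _ x∈₁ = y∈

-- `_<∣>_` prefers its first argument, so a written value overrides the value fixed by the subcube.
image : Assignments n → Cube n → Cube n
image = zipWith _<∣>_

fixed-image : ∀ {as : Assignments n} {C} → as within C → fixed (image as C) ≡ fixed C
fixed-image []                         = refl
fixed-image (keep {m = nothing} w) = fixed-image w
fixed-image (keep {m = just _} w)  = cong suc (fixed-image w)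
fixed-image (set w)                    = cong suc (fixed-image w)

map-assign-∷ : ∀ a b (as : Assignments n) xs →
  map (assign (a ∷ as)) (map (b ∷_) xs) ≡ map (fromMaybe b a ∷_) (map (assign as) xs)
map-assign-∷ a b as xs = trans (sym (map-∘ xs)) (map-∘ xs)

points-image : ∀ {as : Assignments n} {C} → as within C →
               points (image as C) ≡ map (assign as) (points C)
points-image [] = refl
points-image (keep {as = as} {C} {nothing} w) = begin
  map (false ∷_) (points (image as C)) ++ map (true ∷_) (points (image as C))
    ≡⟨ cong (λ ps → map (false ∷_) ps ++ map (true ∷_) ps) (points-image w) ⟩
  map (false ∷_) (map (assign as) (points C)) ++ map (true ∷_) (map (assign as) (points C))
    ≡⟨ cong₂ _++_ (map-assign-∷ nothing false as (points C)) (map-assign-∷ nothing true as (points C)) ⟨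
  map (assign (nothing ∷ as)) (map (false ∷_) (points C)) ++
  map (assign (nothing ∷ as)) (map (true ∷_) (points C))
    ≡⟨ map-++ _ (map (false ∷_) (points C)) _ ⟨
  map (assign (nothing ∷ as)) (points (nothing ∷ C)) ∎
points-image (keep {as = as} {C} {just c} w) =
  trans (cong (map (c ∷_)) (points-image w)) (sym (map-assign-∷ nothing c as (points C)))
points-image (set {as = as} {C} {b} {c} w) =
  trans (cong (map (b ∷_)) (points-image w)) (sym (map-assign-∷ (just b) c as (points C)))

-- The subcubes of inputs that reach the leaves of a tree

Region : ℕ → Set
Region n = Cube n × Assignments n

regionPoints : List (Region n) → List (Bits n)
regionPoints = concatMap (points ∘ proj₁)

-- A query of a position that is already fixed follows the one child that can be reached, so leaves
-- that no input in `C` reaches contribute no region.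
regions : DAT n → Cube n → List (Region n)
regions (leaf as)    C = [ C , as ]
regions (node p l r) C with lookup C p
... | nothing    = regions l (C [ p ]≔ just false) ++ regions r (C [ p ]≔ just true)
... | just false = regions l C
... | just true  = regions r C

-- Lists record multiplicity, so this says that the regions partition `C`; their disjointness will
-- follow from the absence of repetitions.
regionPoints-↭ : ∀ (t : DAT n) C → regionPoints (regions t C) ↭ points C
regionPoints-↭ (leaf as)    C = ↭-reflexive (++-identityʳ (points C))
regionPoints-↭ (node p l r) C with lookup C p in eq
... | just false = regionPoints-↭ l C
... | just true  = regionPoints-↭ r C
... | nothing    =
  ↭-trans (↭-reflexive (concatMap-++ _ (regions l (C [ p ]≔ just false)) _))
  (↭-trans (↭-++⁺ (regionPoints-↭ l _) (regionPoints-↭ r _)) (points-split C p eq))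

output-node : ∀ (t : Bool → DAT n) p x {b} → lookup x p ≡ b →
              output (node p (t false) (t true)) x ≡ output (t b) x
output-node t p x refl with lookup x p
... | false = refl
... | true  = refl

bitsRead-node : ∀ (t : Bool → DAT n) p x {b} → lookup x p ≡ b →
                bitsRead (node p (t false) (t true)) x ≡ suc (bitsRead (t b) x)
bitsRead-node t p x refl with lookup x p
... | false = refl
... | true  = refl

-- The tree `t` is started with the positions of `C` already known. `fixed≤` is only an inequality
-- because repeated queries read bits without fixing new positions.
record Describes (t : DAT n) (C : Cube n) (R : Region n) (x : Bits n) : Set where
  constructor describes
  field
    ∈-cube  : x ∈ points C
    output≡ : output t x ≡ assign (proj₂ R) x
    fixed≤  : fixed (proj₁ R) ≤ fixed C + bitsRead t x

open Describes

-- The query repeats a known position, so `fixed≤` gains one unit of slack.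
describes-child : ∀ (t : Bool → DAT n) p {b C R x} → lookup C p ≡ just b →
  Describes (t b) C R x → Describes (node p (t false) (t true)) C R x
describes-child t p {C = C} {x = x} Cₚ d = describes (∈-cube d)
  (trans (output-node t p x xₚ) (output≡ d))
  (≤-trans (fixed≤ d) (+-monoʳ-≤ (fixed C)
    (≤-trans (n≤1+n _) (≤-reflexive (sym (bitsRead-node t p x xₚ))))))
  where xₚ = lookup-points C p Cₚ (∈-cube d)

-- The position newly fixed for the child is paid for by the bit read at the node.
describes-split : ∀ (t : Bool → DAT n) p b {C R x} → lookup C p ≡ nothing →
  Describes (t b) (C [ p ]≔ just b) R x → Describes (node p (t false) (t true)) C R x
describes-split t p b {C} {R} {x} Cₚ d = describes
  (∈-resp-↭ (points-split C p Cₚ) (∈-half b (∈-cube d)))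
  (trans (output-node t p x xₚ) (output≡ d))
  (≤-trans (fixed≤ d) (≤-reflexive (begin
    fixed (C [ p ]≔ just b) + bitsRead (t b) x ≡⟨ cong (_+ bitsRead (t b) x) (fixed-update C p b Cₚ) ⟩
    suc (fixed C + bitsRead (t b) x)           ≡⟨ +-suc (fixed C) _ ⟨
    fixed C + suc (bitsRead (t b) x)           ≡⟨ cong (fixed C +_) (bitsRead-node t p x xₚ) ⟨
    fixed C + bitsRead (node p (t false) (t true)) x ∎)))
  where
  xₚ = lookup-points (C [ p ]≔ just b) p (lookup∘updateAt p C) (∈-cube d)
  ∈-half : ∀ b {x} → x ∈ points (C [ p ]≔ just b) →
           x ∈ points (C [ p ]≔ just false) ++ points (C [ p ]≔ just true)
  ∈-half false = ∈-++⁺ˡ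
  ∈-half true  = ∈-++⁺ʳ _

regions-describe : ∀ (t : DAT n) C →
  All (λ R → ∀ x → x ∈ points (proj₁ R) → Describes t C R x) (regions t C)
regions-describe (leaf as)    C = (λ _ x∈ → describes x∈ refl (m≤m+n _ _)) ∷ []
regions-describe (node p l r) C with lookup C p in Cₚ
... | just false =
  All.map (λ d x x∈ → describes-child child p Cₚ (d x x∈)) (regions-describe l C)
  where child = λ b → if b then r else l
... | just true  =
  All.map (λ d x x∈ → describes-child child p Cₚ (d x x∈)) (regions-describe r C)
  where child = λ b → if b then r else l
... | nothing    = ++⁺
  (All.map (λ d x x∈ → describes-split child p false Cₚ (d x x∈)) (regions-describe l _))
  (All.map (λ d x x∈ → describes-split child p true Cₚ (d x x∈)) (regions-describe r _))
  where child = λ b → if b then r else l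

-- The parity of an injective map acting by shallow regions

module _ {f : Bits n → Bits n} (f-inj : ∀ {x y} → f x ≡ f y → x ≡ y) where

  record Shallow (R : Region n) : Set where
    constructor shallow
    field
      acts : ∀ {x} → x ∈ points (proj₁ R) → f x ≡ assign (proj₂ R) x
      few  : fixed (proj₁ R) + fixed (proj₁ R) < n

    writes-fixed : proj₂ R within proj₁ R
    writes-fixed = injective⇒within (proj₂ R) (proj₁ R) λ x∈ y∈ eq →
      f-inj (trans (acts x∈) (trans eq (sym (acts y∈))))

  open Shallow

  -- The sum is at most twice the larger of the two counts.
  few-fixed : ∀ {R S} → Shallow R → Shallow S → fixed (proj₁ R) + fixed (proj₁ S) < n
  few-fixed {C , _} {D , _} r s with ≤-total (fixed C) (fixed D)
  ... | inj₁ C≤D = ≤-<-trans (+-monoˡ-≤ (fixed D) C≤D) (few s)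
  ... | inj₂ D≤C = ≤-<-trans (+-monoʳ-≤ (fixed C) D≤C) (few r)

  inverts-inside : ∀ {R x y} → Shallow R → x ∈ points (proj₁ R) → y ∈ points (proj₁ R) →
                   inverts f x y ≡ false
  inverts-inside {R} {x} {y} r x∈ y∈ = begin
    precedes x y xor precedes (f x) (f y)
      ≡⟨ cong₂ (λ x′ y′ → precedes x y xor precedes x′ y′) (acts r x∈) (acts r y∈) ⟩
    precedes x y xor precedes (assign (proj₂ R) x) (assign (proj₂ R) y)
      ≡⟨ cong (precedes x y xor_) (precedes-assign (writes-fixed r) x∈ y∈) ⟩
    precedes x y xor precedes x y
      ≡⟨ xor-same (precedes x y) ⟩
    false ∎

  -- The sum separates into one over the subcubes and one over their images. By injectivity the
  -- images are again disjoint subcubes, with equally many fixed positions, so `cross-even` applies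
  -- to both.
  inverts-between : ∀ {R S} → Shallow R → Shallow S →
    Disjoint (points (proj₁ R)) (points (proj₁ S)) →
    ⨁² (inverts f) (points (proj₁ R)) (points (proj₁ S)) ≡ false
  inverts-between {C , as} {D , bs} r s C#D = begin
    ⨁² (inverts f) (points C) (points D)
      ≡⟨ ⨁²-xor precedes (λ x y → precedes (f x) (f y)) (points C) (points D) ⟩
    cross C D xor ⨁² (λ x y → precedes (f x) (f y)) (points C) (points D)
      ≡⟨ cong₂ _xor_ (cross-even C D C#D (few-fixed r s)) images ⟩
    false ∎
    where
    images# : Disjoint (points (image as C)) (points (image bs D))
    images# (v∈C , v∈D)
      with x , x∈ , v≡x ← ∈-map⁻ _ (subst (_ ∈_) (points-image (writes-fixed r)) v∈C)
         | y , y∈ , v≡y ← ∈-map⁻ _ (subst (_ ∈_) (points-image (writes-fixed s)) v∈D)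
      with refl ← f-inj (trans (acts r x∈) (trans (trans (sym v≡x) v≡y) (sym (acts s y∈))))
      = C#D (x∈ , y∈)

    images : ⨁² (λ x y → precedes (f x) (f y)) (points C) (points D) ≡ false
    images = begin
      ⨁² (λ x y → precedes (f x) (f y)) (points C) (points D)
        ≡⟨ ⨁²-cong (points C) (points D) (λ x∈ y∈ → cong₂ precedes (acts r x∈) (acts s y∈)) ⟩
      ⨁² (λ x y → precedes (assign as x) (assign bs y)) (points C) (points D)
        ≡⟨ ⨁²-map precedes (assign as) (assign bs) (points C) (points D) ⟨
      ⨁² precedes (map (assign as) (points C)) (map (assign bs) (points D))
        ≡⟨ cong₂ (⨁² precedes) (points-image (writes-fixed r)) (points-image (writes-fixed s)) ⟨
      cross (image as C) (image bs D)
        ≡⟨ cross-even (image as C) (image bs D) images# (subst₂ (λ c d → c + d < n)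
             (sym (fixed-image (writes-fixed r))) (sym (fixed-image (writes-fixed s))) (few-fixed r s)) ⟩
      false ∎

  inverts-between-all : ∀ {R Rs} → Shallow R → All Shallow Rs →
    Disjoint (points (proj₁ R)) (regionPoints Rs) →
    ⨁² (inverts f) (points (proj₁ R)) (regionPoints Rs) ≡ false
  inverts-between-all {R} r [] _ = ⨁-false (points (proj₁ R))
  inverts-between-all {R} {S ∷ Rs} r (s ∷ rs) R#S∷Rs =
    trans (⨁²-++ʳ (inverts f) (points (proj₁ R)) (points (proj₁ S)) _)
      (cong₂ _xor_ (inverts-between r s λ (v∈R , v∈S) → R#S∷Rs (v∈R , ∈-++⁺ˡ v∈S))
                   (inverts-between-all r rs λ (v∈R , v∈Rs) → R#S∷Rs (v∈R , ∈-++⁺ʳ _ v∈Rs)))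

  shallow-even : ∀ {Rs} → All Shallow Rs → Unique (regionPoints Rs) →
                 ⨁-pairs (inverts f) (regionPoints Rs) ≡ false
  shallow-even [] _ = refl
  shallow-even {R ∷ Rs} (r ∷ rs) unique =
    let Rs! , R#Rs = Unique-++⁻ (points (proj₁ R)) unique in
    trans (⨁-pairs-++ (inverts f) (points (proj₁ R)) (regionPoints Rs))
      (cong₂ _xor_ (inverts-between-all r rs R#Rs)
        (cong₂ _xor_ (⨁-pairs-false (points (proj₁ R)) (inverts-inside r)) (shallow-even rs Rs!)))

-- The increment function of a code

module _ {n : ℕ} (code : SpaceOptimalCode n) where

  open Inverse code renaming (to to Enc; from to Dec)

  codewords : List (Bits n)
  codewords = tabulate Enc

  Enc-injective : ∀ {i j} → Enc i ≡ Enc j → i ≡ j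
  Enc-injective {i} {j} eq = trans (sym (strictlyInverseʳ i)) (trans (cong Dec eq) (strictlyInverseʳ j))

  codewords-unique : Unique codewords
  codewords-unique = Unique.tabulate⁺ Enc-injective

  codewords-↭ : codewords ↭ points (free n)
  codewords-↭ = ∼bag⇒↭ (unique∧set⇒bag codewords-unique (points-unique (free n)) λ {x} →
    mk⇔ (λ _ → ∈-free x)
        (λ _ → subst (_∈ codewords) (strictlyInverseˡ x) (∈-tabulate⁺ {f = Enc} (Dec x))))

  -- In the order of the code, `Inc` is a rotation, so the parity is that of the number of codewords
  -- after the first.
  Inc-odd : 1 ≤ n → ⨁-pairs (inverts (Inc code)) codewords ≡ true
  Inc-odd 1≤n with x , xs , eq , eq′ ← tabulate-rotate {m = 2 ^ n} {{m^n≢0 2 n}} Enc = begin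
    ⨁-pairs (inverts (Inc code)) codewords
      ≡⟨ ⨁-pairs-xor precedes _ codewords ⟩
    ⨁-pairs precedes codewords xor ⨁-pairs (λ x y → precedes (Inc code x) (Inc code y)) codewords
      ≡⟨ cong (⨁-pairs precedes codewords xor_) (⨁-pairs-map precedes (Inc code) codewords) ⟨
    ⨁-pairs precedes codewords xor ⨁-pairs precedes (map (Inc code) codewords)
      ≡⟨ cong₂ (λ xs ys → ⨁-pairs precedes xs xor ⨁-pairs precedes ys) eq (trans Inc-codewords eq′) ⟩
    ⨁-pairs precedes (x ∷ xs) xor ⨁-pairs precedes (xs ++ [ x ])
      ≡⟨ rotation-odd x xs (subst Unique eq codewords-unique) ⟩
    ⨁ (λ _ → true) xs
      -- Restoring `x` flips the parity to that of all codewords, whose number is even because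
      -- `1 ≤ n`.
      ≡⟨ not-involutive (⨁ (λ _ → true) xs) ⟨
    not (⨁ (λ _ → true) (x ∷ xs))
      ≡⟨ cong (not ∘ ⨁ (λ _ → true)) eq ⟨
    not (⨁ (λ _ → true) codewords)
      ≡⟨ cong not (trans (⨁-↭ _ codewords-↭)
           (∣points∣-even (free n) (subst (_< n) (sym (fixed-free n)) 1≤n))) ⟩
    true ∎
    where
    Inc-codewords : map (Inc code) codewords ≡
                    tabulate (λ i → Enc (_mod_ (suc (toℕ i)) (2 ^ n) {{m^n≢0 2 n}}))
    Inc-codewords = trans (map-tabulate Enc (Inc code)) (tabulate-cong λ i →
      cong (λ j → Enc (_mod_ (suc (toℕ j)) (2 ^ n) {{m^n≢0 2 n}})) (strictlyInverseʳ i))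

  Inc-injective : ∀ {x y} → Inc code x ≡ Inc code y → x ≡ y
  Inc-injective {x} {y} eq = begin
    x           ≡⟨ strictlyInverseˡ x ⟨
    Enc (Dec x) ≡⟨ cong Enc (suc-mod-injective {{m^n≢0 2 n}} (Enc-injective eq)) ⟩
    Enc (Dec y) ≡⟨ strictlyInverseˡ y ⟩
    y           ∎

  shallow⇒Inc-even : ∀ t → Implements t (Inc code) → (∀ x → 2 * bitsRead t x < n) →
                     ⨁-pairs (inverts (Inc code)) codewords ≡ false
  shallow⇒Inc-even t t-Inc few-reads =
    trans (⨁-pairs-↭ (inverts (Inc code)) (inverts-sym (Inc code) Inc-injective) codewords-↭regions)
      (shallow-even Inc-injective (All.map shallow-region (regions-describe t (free n)))
        -- Uniqueness survives the rearrangement by regions and makes distinct regions disjoint.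
        (Permutationₛ.Unique-resp-↭ (setoid _) (↭⇒↭ₛ codewords-↭regions) codewords-unique))
    where
    codewords-↭regions : codewords ↭ regionPoints (regions t (free n))
    codewords-↭regions = ↭-trans codewords-↭ (↭-sym (regionPoints-↭ t (free n)))

    shallow-region : ∀ {R} → (∀ x → x ∈ points (proj₁ R) → Describes t (free n) R x) →
                     Shallow Inc-injective R
    -- The subcube is nonempty, so the bound on the bits read at one of its points bounds its fixed
    -- positions.
    shallow-region {C , as} d with x , x∈ ← points-nonempty C = shallow
      (λ x∈ → trans (sym (t-Inc _)) (output≡ (d _ x∈)))
      -- `2 * k` unfolds to `k + (k + 0)`, whence the summand `0`.
      (≤-<-trans (+-mono-≤ C≤reads (≤-trans C≤reads (m≤m+n _ 0))) (few-reads x))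
      where
      C≤reads : fixed C ≤ bitsRead t x
      C≤reads = subst (λ k → fixed C ≤ k + bitsRead t x) (fixed-free n) (fixed≤ (d x x∈))

theorem2 : ∀ (n : ℕ) → 1 ≤ n → (code : SpaceOptimalCode n) (t : DAT n) →
    Implements t (Inc code) →
    ∃[ x ] n ≤ 2 * bitsRead t x
-- Every input is a codeword, so a search over the finitely many indices decides whether a deep
-- input exists and supplies the witness.
theorem2 n 1≤n code t t-Inc with any? (λ i → n ≤? 2 * bitsRead t (Inverse.to code i))
... | yes (i , deep) = Inverse.to code i , deep
... | no ¬deep = contradiction
  (trans (sym (Inc-odd code 1≤n)) (shallow⇒Inc-even code t t-Inc few-reads)) λ ()
  where
  few-reads : ∀ x → 2 * bitsRead t x < n
  few-reads x = ≰⇒> λ deep → ¬deep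
    (Inverse.from code x , subst (λ y → n ≤ 2 * bitsRead t y) (sym (Inverse.strictlyInverseˡ code x)) deep)
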